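{- Let $n\ge 4$ and let $T_1'$ and $T_2'$ be $(n-2)$-leaf binary trees. Let $1 \leq i \leq n-2$, and let $T_1$ and $T_2$ be the $n$-leaf trees obtained from $T_1'$ and $T_2'$ by triplicating leaf $i$. If $w = w_1 \cdots w_{n-2}$ is a parse word for $T_1'$ and $T_2'$ (i.e. both trees parse $w$), then $w_1 \cdots w_{i-1} w_i w_i w_i w_{i+1} \cdots w_{n-2}$ is a parse word for $T_1$ and $T_2$.
   Context: A binary tree is a rooted ordered tree in which each vertex has either $0$ or $2$ children; its leaves are numbered $1,2,\dots$ from left to right. Let $G$ be the context-free grammar with start symbols $0,1,2$ and rules $0\to 12$, $0\to 21$, $1\to 02$, $1\to 20$, $2\to 01$, $2\to 10$. An $n$-leaf binary tree $T$ parses a word $w$ of length $n$ on $\{0,1,2\}$ if there is a labeling of the vertices of $T$ by $0,1,2$ such that the leaves, from left to right, are labeled with the letters of $w$, and at every internal vertex the label of the vertex together with the labels of its left and right children form a rule of $G$ (i.e. the three labels are pairwise distinct). Triplicating leaf $i$ of a binary tree $T'$ with at least two leaves: let $S$ be the subtree hanging from the sibling vertex of leaf $i$. Writing $(A,B)$ for the tree with left subtree $A$ and right subtree $B$ and $\bullet$ for a leaf, the subtree of $T'$ at the parent of leaf $i$ is changed from $(\bullet,S)$ to $(\bullet,(\bullet,(\bullet,S)))$ if leaf $i$ is a left child, and from $(S,\bullet)$ to $(((S,\bullet),\bullet),\bullet)$ if leaf $i$ is a right child; the rest of the tree is unchanged. The resulting tree has two more leaves than $T'$. -}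

module Defs where

open import Data.Fin.Base using (Fin; zero; suc; splitAt)
open import Data.Fin.Patterns using (0F; 1F; 2F)
open import Data.Nat.Base using (ℕ; suc; _+_; _≤_; s≤s)
open import Data.Nat.Properties using (+-comm; +-suc)
open import Data.Product.Base using (Σ-syntax; ∃-syntax; _×_; _,_)
open import Data.Sum.Base using (inj₁; inj₂)
open import Data.Tree.Binary using (Tree; leaf; node; #leaves)
open import Data.Tree.Binary.Relation.Unary.All using (All; leaf; node)
open import Data.Unit.Base using (⊤; tt)
open import Data.Vec.Base using (Vec; _∷_; [_]; _++_)
open import Relation.Binary.PropositionalEquality using (_≡_; refl; cong; trans)

BinaryTree : Set
BinaryTree = Tree ⊤ ⊤

pattern •       = leaf tt
pattern ⟨_,_⟩ A B = node A tt B

NLeafTree : ℕ → Set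
NLeafTree n = Σ[ T ∈ BinaryTree ] #leaves T ≡ n

Letter : Set
Letter = Fin 3

-- Rule a b c is the rule a → b c.  All letters are start symbols, so no
-- condition is ever imposed on the label of the root of a tree.
data Rule : Letter → Letter → Letter → Set where
  0→12 : Rule 0F 1F 2F
  0→21 : Rule 0F 2F 1F
  1→02 : Rule 1F 0F 2F
  1→20 : Rule 1F 2F 0F
  2→01 : Rule 2F 0F 1F
  2→10 : Rule 2F 1F 0F

Labelling : BinaryTree → Set
Labelling = All (λ _ → Letter) (λ _ → Letter)

rootLabel : ∀ {T} → Labelling T → Letter
rootLabel (leaf a)     = a
rootLabel (node _ a _) = a

leafWord : ∀ {T} → Labelling T → Vec Letter (#leaves T)
leafWord (leaf a)     = [ a ]
leafWord (node l _ r) = leafWord l ++ leafWord r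

data FollowsRules : ∀ {T} → Labelling T → Set where
  leaf : ∀ {a} → FollowsRules {•} (leaf a)
  node : ∀ {A B a} {l : Labelling A} {r : Labelling B} →
         FollowsRules l → Rule a (rootLabel l) (rootLabel r) → FollowsRules r →
         FollowsRules {⟨ A , B ⟩} (node l a r)

Parses : ∀ {n} → NLeafTree n → Vec Letter n → Set
Parses (T , refl) w = ∃[ ℓ ] FollowsRules {T} ℓ × leafWord ℓ ≡ w

-- triplicateAt A B i triplicates leaf i of ⟨ A , B ⟩; positions are counted
-- from 0.  The two auxiliary functions treat the leaves of A and those of B.
-- A leaf with no sibling never arises, since ⟨ A , B ⟩ has at least two leaves.
mutual
  triplicateAt : (A B : BinaryTree) → Fin (#leaves A + #leaves B) → BinaryTree
  triplicateAt A B i with splitAt (#leaves A) i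
  ... | inj₁ j = triplicateInLeft A B j
  ... | inj₂ j = triplicateInRight A B j

  triplicateInLeft : (A B : BinaryTree) → Fin (#leaves A) → BinaryTree
  triplicateInLeft •           S _ = ⟨ • , ⟨ • , ⟨ • , S ⟩ ⟩ ⟩
  triplicateInLeft ⟨ A₁ , A₂ ⟩ B j = ⟨ triplicateAt A₁ A₂ j , B ⟩

  triplicateInRight : (A B : BinaryTree) → Fin (#leaves B) → BinaryTree
  triplicateInRight S •           _ = ⟨ ⟨ ⟨ S , • ⟩ , • ⟩ , • ⟩
  triplicateInRight A ⟨ B₁ , B₂ ⟩ j = ⟨ A , triplicateAt B₁ B₂ j ⟩

mutual
  #leaves-triplicateAt : ∀ A B i →
    #leaves (triplicateAt A B i) ≡ 2 + (#leaves A + #leaves B)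
  #leaves-triplicateAt A B i with splitAt (#leaves A) i
  ... | inj₁ j = #leaves-triplicateInLeft A B j
  ... | inj₂ j = #leaves-triplicateInRight A B j

  #leaves-triplicateInLeft : ∀ A B j →
    #leaves (triplicateInLeft A B j) ≡ 2 + (#leaves A + #leaves B)
  #leaves-triplicateInLeft •           S _ = refl
  #leaves-triplicateInLeft ⟨ A₁ , A₂ ⟩ B j =
    cong (_+ #leaves B) (#leaves-triplicateAt A₁ A₂ j)

  #leaves-triplicateInRight : ∀ A B j →
    #leaves (triplicateInRight A B j) ≡ 2 + (#leaves A + #leaves B)
  #leaves-triplicateInRight S •           _ =
    trans (+-comm (#leaves S + 1 + 1) 1) (cong suc (+-comm (#leaves S + 1) 1))
  #leaves-triplicateInRight A ⟨ B₁ , B₂ ⟩ j =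
    trans (cong (#leaves A +_) (#leaves-triplicateAt B₁ B₂ j))
          (trans (+-suc (#leaves A) _) (cong suc (+-suc (#leaves A) _)))

triplicate : ∀ {n} → NLeafTree n → 2 ≤ n → Fin n → NLeafTree (2 + n)
triplicate (•         , refl) (s≤s ())
triplicate (⟨ A , B ⟩ , refl) _ i = triplicateAt A B i , #leaves-triplicateAt A B i

triplicateLetter : ∀ {a n} {X : Set a} → Vec X n → Fin n → Vec X (2 + n)
triplicateLetter (x ∷ xs) zero    = x ∷ x ∷ x ∷ xs
triplicateLetter (x ∷ xs) (suc i) = x ∷ triplicateLetter xs i

-- If c → a b labels a leaf a, its sibling b and their parent c, then the path
-- of new internal vertices can be labelled c, b, c from top to bottom: the
-- three rules needed are c → a b, b → a c, c → a b (or their mirror images).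
-- The labels of the parent and of S are unchanged, so the rest of the labelling
-- survives.
module Submission where

open import Defs
open import Data.Fin.Base using (Fin; zero; suc; splitAt)
open import Data.List.Base using (List; []; _∷_; _++_)
open import Data.List.Properties using (++-assoc)
open import Data.Nat.Base using (ℕ; suc; _+_; _≤_; _∸_; s≤s)
open import Data.Nat.Properties using (∸-monoˡ-≤)
open import Data.Product.Base using (Σ-syntax; _×_; _,_)
open import Data.Sum.Base using (inj₁; inj₂; [_,_]′)
open import Data.Tree.Binary using (#leaves)
open import Data.Tree.Binary.Relation.Unary.All using (leaf; node)
open import Data.Vec.Base as Vec using (Vec; []; _∷_; toList)
open import Data.Vec.Properties using (toList-++; toList-injective; cast-is-id)
open import Relation.Binary.PropositionalEquality
  using (_≡_; refl; sym; trans; cong; subst)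

-- Words are lists here because #leaves-triplicateAt is not a definitional equality.
Derives : BinaryTree → Letter → List Letter → Set
Derives T a u =
  Σ[ ℓ ∈ Labelling T ] FollowsRules ℓ × rootLabel ℓ ≡ a × toList (leafWord ℓ) ≡ u

derivation : ∀ {T} {ℓ : Labelling T} → FollowsRules ℓ →
             Derives T (rootLabel ℓ) (toList (leafWord ℓ))
derivation {ℓ = ℓ} f = ℓ , f , refl , refl

leaf-derives : ∀ a → Derives • a (a ∷ [])
leaf-derives a = derivation (leaf {a})

node-derives : ∀ {A B a b c u v} → Rule a b c → Derives A b u → Derives B c v →
               Derives ⟨ A , B ⟩ a (u ++ v)
node-derives ρ (ℓ , f , refl , refl) (r , g , refl , refl) =
  node ℓ _ r , node f ρ g , refl , toList-++ (leafWord ℓ) (leafWord r)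

-- A rule only asks that its three labels be pairwise distinct, so parent and child may trade
-- places. This gives the rule at the middle new vertex, which takes the label of the sibling, when
-- the tripled leaf is a left child.
Rule-swap-right : ∀ {a b c} → Rule a b c → Rule c b a
Rule-swap-right 0→12 = 2→10
Rule-swap-right 0→21 = 1→20
Rule-swap-right 1→02 = 2→01
Rule-swap-right 1→20 = 0→21
Rule-swap-right 2→01 = 1→02
Rule-swap-right 2→10 = 0→12

-- The mirror image, for a tripled leaf that is a right child.
Rule-swap-left : ∀ {a b c} → Rule a b c → Rule b a c
Rule-swap-left 0→12 = 1→02
Rule-swap-left 0→21 = 2→01
Rule-swap-left 1→02 = 0→12
Rule-swap-left 1→20 = 2→10
Rule-swap-left 2→01 = 0→21
Rule-swap-left 2→10 = 1→20

-- The right side branches on the same `splitAt` as `triplicateAt`, so that a single case split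
-- reduces the tree and the word together.
toList-triplicateLetter-++ :
  ∀ {a m n} {X : Set a} (xs : Vec X m) (ys : Vec X n) (i : Fin (m + n)) →
  toList (triplicateLetter (xs Vec.++ ys) i) ≡
  [ (λ j → toList (triplicateLetter xs j) ++ toList ys)
  , (λ j → toList xs ++ toList (triplicateLetter ys j)) ]′ (splitAt m i)
toList-triplicateLetter-++ []       ys i    = refl
toList-triplicateLetter-++ (x ∷ xs) ys zero =
  cong (λ us → x ∷ x ∷ x ∷ us) (toList-++ xs ys)
toList-triplicateLetter-++ {m = suc m} (x ∷ xs) ys (suc i)
  with splitAt m i | toList-triplicateLetter-++ xs ys i
... | inj₁ _ | eq = cong (x ∷_) eq
... | inj₂ _ | eq = cong (x ∷_) eq

mutual
  -- Keeping the root label `a` is the induction invariant: it lets the rule at every ancestor be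
  -- reused as it stands.
  triplicateAt-derives :
    ∀ {A B a} {ℓ : Labelling A} {r : Labelling B} →
    FollowsRules ℓ → Rule a (rootLabel ℓ) (rootLabel r) → FollowsRules r → ∀ i →
    Derives (triplicateAt A B i) a
            (toList (triplicateLetter (leafWord ℓ Vec.++ leafWord r) i))
  triplicateAt-derives {A} {ℓ = ℓ} {r} f ρ g i
    rewrite toList-triplicateLetter-++ (leafWord ℓ) (leafWord r) i
    with splitAt (#leaves A) i
  ... | inj₁ j = triplicateInLeft-derives f ρ g j
  ... | inj₂ j = triplicateInRight-derives f ρ g j

  triplicateInLeft-derives :
    ∀ {A B a} {ℓ : Labelling A} {r : Labelling B} →
    FollowsRules ℓ → Rule a (rootLabel ℓ) (rootLabel r) → FollowsRules r → ∀ j →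
    Derives (triplicateInLeft A B j) a
            (toList (triplicateLetter (leafWord ℓ) j) ++ toList (leafWord r))
  triplicateInLeft-derives (leaf {b}) ρ g zero =
    node-derives ρ (leaf-derives b)
      (node-derives (Rule-swap-right ρ) (leaf-derives b)
        (node-derives ρ (leaf-derives b) (derivation g)))
  triplicateInLeft-derives (node f₁ σ f₂) ρ g j =
    node-derives ρ (triplicateAt-derives f₁ σ f₂ j) (derivation g)

  triplicateInRight-derives :
    ∀ {A B a} {ℓ : Labelling A} {r : Labelling B} →
    FollowsRules ℓ → Rule a (rootLabel ℓ) (rootLabel r) → FollowsRules r → ∀ j →
    Derives (triplicateInRight A B j) a
            (toList (leafWord ℓ) ++ toList (triplicateLetter (leafWord r) j))
  triplicateInRight-derives {A} {a = a} {ℓ} f ρ (leaf {c}) zero =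
    -- Here the new leaves are appended to `u` one at a time, and these appends are stuck on `u`; on
    -- the left side they compute.
    subst (Derives ⟨ ⟨ ⟨ A , • ⟩ , • ⟩ , • ⟩ a) assoc
      (node-derives ρ
        (node-derives (Rule-swap-left ρ)
          (node-derives ρ (derivation f) (leaf-derives c))
          (leaf-derives c))
        (leaf-derives c))
    where
    u = toList (leafWord ℓ)
    assoc : ((u ++ c ∷ []) ++ c ∷ []) ++ c ∷ [] ≡ u ++ c ∷ c ∷ c ∷ []
    assoc = trans (++-assoc (u ++ c ∷ []) _ _) (++-assoc u _ _)
  triplicateInRight-derives f ρ (node g₁ σ g₂) j =
    node-derives ρ (derivation f) (triplicateAt-derives g₁ σ g₂ j)

-- Leaving `n` and `eq` general allows matching on `refl`, which is impossible for
-- `#leaves-triplicateAt` itself. Equal lists then give equal vectors of the same length.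
derives⇒parses : ∀ {n a T} {w : Vec Letter n} (eq : #leaves T ≡ n) →
                 Derives T a (toList w) → Parses (T , eq) w
derives⇒parses {w = w} refl (ℓ , f , _ , eq) =
  ℓ , f , trans (sym (cast-is-id refl _)) (toList-injective refl (leafWord ℓ) w eq)

triplicate-parses : ∀ {n} (T : NLeafTree n) (2≤n : 2 ≤ n) (i : Fin n) (w : Vec Letter n) →
                    Parses T w → Parses (triplicate T 2≤n i) (triplicateLetter w i)
triplicate-parses (•         , refl) (s≤s ())
triplicate-parses (⟨ A , B ⟩ , refl) _ i _ (_ , node f ρ g , refl) =
  derives⇒parses (#leaves-triplicateAt A B i) (triplicateAt-derives f ρ g i)

theorem18 : (n : ℕ) (n≥4 : 4 ≤ n) (T₁′ T₂′ : NLeafTree (n ∸ 2)) (i : Fin (n ∸ 2)) →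
    let T₁ = triplicate T₁′ (∸-monoˡ-≤ 2 n≥4) i
        T₂ = triplicate T₂′ (∸-monoˡ-≤ 2 n≥4) i
    in (w : Vec Letter (n ∸ 2)) → Parses T₁′ w → Parses T₂′ w →
       Parses T₁ (triplicateLetter w i) × Parses T₂ (triplicateLetter w i)
theorem18 n n≥4 T₁′ T₂′ i w p₁ p₂ =
  -- The trees do not interact: the new word depends only on `w` and `i`.
  triplicate-parses T₁′ _ i w p₁ , triplicate-parses T₂′ _ i w p₂
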